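{- Let $A$ be a wqo. If $\mathbf{w}(A)$ is infinite then $\mathbf{w}(\mathcal{P}_f(A))\ge 2^{\mathbf{w}(A)}$. If $\mathbf{w}(A)=k<\omega$ then $\mathbf{w}(\mathcal{P}_f(A))\ge \mathbf{w}(\mathcal{P}_f(\Gamma_k))$.
   Context: A quasi-order $(A,\le)$ is a well-quasi-order (wqo) if every infinite sequence $x_0,x_1,\dots$ in $A$ has indices $i<j$ with $x_i\le x_j$. For a wqo $A$, let $\mathrm{Bad}(A)$, $\mathrm{Dec}(A)$, $\mathrm{Inco}(A)$ be the trees of finite bad sequences (sequences with no $i<j$, $x_i\le x_j$), finite strictly decreasing sequences, and finite sequences of pairwise incomparable elements of $A$, respectively; the root is the empty sequence and the children of a sequence are its one-element extensions. These trees are well-founded; the rank of a node $s$ is $r(s)=\sup\{r(t)+1 : t \text{ a child of } s\}$. The maximal order type $\mathbf{o}(A)$, height $\mathbf{h}(A)$ and width $\mathbf{w}(A)$ are the ranks of the roots of $\mathrm{Bad}(A)$, $\mathrm{Dec}(A)$, $\mathrm{Inco}(A)$ respectively. $\mathcal{P}_f(A)$ denotes the set of finite subsets of $A$ ordered by the Hoare embedding: $S\le_H S'$ iff for every $a\in S$ there is $b\in S'$ with $a\le b$. $\Gamma_k$ denotes a $k$-element antichain (so $\mathcal{P}_f(\Gamma_k)$ is the set of subsets of a $k$-element set ordered by inclusion). -}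

module Defs where

open import Axiom.ExcludedMiddle using (ExcludedMiddle)
open import Data.Empty.Polymorphic using (⊥)
open import Data.Fin.Base using (Fin; toℕ)
open import Data.Fin.Properties using (pigeonhole)
open import Data.List.Base using (List; []; _∷_)
import Data.List.Membership.Propositional as Propositional
import Data.List.Membership.Setoid as Membership
import Data.List.Relation.Binary.Subset.Setoid as Subset
open import Data.List.Relation.Unary.All as All using (All)
open import Data.List.Relation.Unary.AllPairs as AllPairs using (AllPairs)
open import Data.List.Relation.Unary.Any using (here; there)
open import Data.Maybe.Base using (Maybe; maybe′)
open import Data.Nat.Base as ℕ using (ℕ; zero; suc)
import Data.Nat.Properties as ℕ
open import Data.Product.Base using (Σ; ∃; ∃₂; _×_; _,_; proj₁; proj₂)
open import Data.Sum.Base using (_⊎_; [_,_])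
open import Data.Unit.Polymorphic using (⊤)
open import Function.Base using (_∘_; id)
open import Induction.WellFounded using (Acc; acc)
open import Level using (Level; Setω; 0ℓ; _⊔_) renaming (suc to lsuc)
open import Relation.Binary.Bundles using (Preorder)
open import Relation.Binary.PropositionalEquality.Core using (_≡_; refl; sym; subst)
import Relation.Binary.PropositionalEquality.Properties as ≡
open import Relation.Nullary.Decidable.Core using (yes; no; decidable-stable)
open import Relation.Nullary.Negation.Core using (¬_; contradiction)

private
  variable
    p q c ℓ ℓ₁ ℓ₂ : Level

-- The theory is classical.  Since `Dec P` for an inhabited P carries an
-- element of P, this form of excluded middle also yields the (dependent)
-- choice needed to pass from "no infinite bad sequence" to well-foundedness.
Classical : Setω
Classical = ∀ {ℓ} → ExcludedMiddle ℓ

-- An ordinal is presented by a well-founded tree: `sup⁺ I f` stands for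
-- sup { f i + 1 ∣ i : I }, the least ordinal strictly above every f i.
-- Different trees may denote the same ordinal; equality is _≃_ below.
data Ord (ℓ : Level) : Set (lsuc ℓ) where
  sup⁺ : (I : Set ℓ) → (I → Ord ℓ) → Ord ℓ

Branch : Ord ℓ → Set ℓ
Branch (sup⁺ I f) = I

branch : (α : Ord ℓ) → Branch α → Ord ℓ
branch (sup⁺ I f) = f

infix 4 _≤_ _≃_

-- sup { f i + 1 } ≤ sup { g j + 1 }  iff  every f i is below some g j.
-- The two sides may live in different universes.
_≤_ : Ord p → Ord q → Set (p ⊔ q)
sup⁺ I f ≤ sup⁺ J g = ∀ i → ∃ λ j → f i ≤ g j

_≃_ : Ord p → Ord q → Set (p ⊔ q)
α ≃ β = (α ≤ β) × (β ≤ α)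

𝟎 : Ord ℓ
𝟎 = sup⁺ ⊥ λ ()

_+1 : Ord ℓ → Ord ℓ
α +1 = sup⁺ ⊤ λ _ → α

fromℕ : ℕ → Ord 0ℓ
fromℕ zero    = 𝟎
fromℕ (suc n) = fromℕ n +1

ω : Ord 0ℓ
ω = sup⁺ ℕ fromℕ

-- sup { f i ∣ i : I }, non-strict: the branches of all the f i together.
⨆ : (I : Set ℓ) → (I → Ord ℓ) → Ord ℓ
⨆ I f = sup⁺ (Σ I (Branch ∘ f)) λ (i , k) → branch (f i) k

infixl 6 _+_

-- α + β = sup ({ α′ + 1 ∣ α′ < α } ∪ { (α + β′) + 1 ∣ β′ < β })
_+_ : Ord ℓ → Ord ℓ → Ord ℓ
α + sup⁺ J g = sup⁺ (Branch α ⊎ J) [ branch α , (λ j → α + g j) ]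

infix 8 2^_

-- 2^α = max (1 , sup { 2^β · 2 ∣ β < α }), where 2^β · 2 = 2^β + 2^β; this
-- merges the clauses for 0, successors and limits.  By monotonicity β need
-- only range over the branches of α, which are cofinal in the sense that
-- every β < α is ≤ one of them.
2^_ : Ord ℓ → Ord ℓ
2^ sup⁺ I f = ⨆ (Maybe I) (maybe′ (λ i → 2^ f i + 2^ f i) (𝟎 +1))

IsWQO : Preorder c ℓ₁ ℓ₂ → Set (c ⊔ ℓ₂)
IsWQO A = (x : ℕ → Carrier) → ∃₂ λ i j → (i ℕ.< j) × (x i ≲ x j)
  where open Preorder A

module Inco (A : Preorder c ℓ₁ ℓ₂) where
  open Preorder A using (Carrier; _≲_)

  Incomparable : Carrier → Carrier → Set ℓ₂
  Incomparable x y = ¬ (x ≲ y) × ¬ (y ≲ x)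

  -- Sequences are listed with the most recent element first, so that a
  -- one-element extension is a cons; incomparability is symmetric, so the
  -- direction of the list does not matter to `AllPairs`.
  Node : Set (c ⊔ ℓ₂)
  Node = ∃ (AllPairs Incomparable)

  root : Node
  root = [] , AllPairs.[]

  infix 4 _IsChildOf_

  _IsChildOf_ : Node → Node → Set c
  t IsChildOf s = ∃ λ x → proj₁ t ≡ x ∷ proj₁ s

  rank : ∀ {s} → Acc _IsChildOf_ s → Ord (c ⊔ ℓ₂)
  rank {s} (acc rs) = sup⁺ (∃ (_IsChildOf s)) λ (t , p) → rank (rs {t} p)

  module _ (em : Classical) (wqo : IsWQO A) where

    root-acc : Acc _IsChildOf_ root
    root-acc = decidable-stable em impossible
      where
      Stuck : Set (c ⊔ ℓ₂)
      Stuck = ∃ λ s → ¬ Acc _IsChildOf_ s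

      step : (s : Stuck) → ∃ λ (t : Stuck) → proj₁ t IsChildOf proj₁ s
      step (s , ¬acc) with em {P = ∃ λ (t : Stuck) → proj₁ t IsChildOf s}
      ... | yes p = p
      ... | no ¬p = contradiction
        (acc λ {t} t◁s → decidable-stable em λ ¬acc-t → ¬p ((t , ¬acc-t) , t◁s))
        ¬acc

      impossible : ¬ ¬ Acc _IsChildOf_ root
      impossible ¬acc = contradict (wqo x)
        where
        open Propositional using (_∈_)

        path : ℕ → Stuck
        path zero    = root , ¬acc
        path (suc n) = proj₁ (step (path n))

        seq : ℕ → List Carrier
        seq n = proj₁ (proj₁ (path n))

        x : ℕ → Carrier
        x n = proj₁ (proj₂ (step (path n)))

        seq-suc : ∀ n → seq (suc n) ≡ x n ∷ seq n
        seq-suc n = proj₂ (proj₂ (step (path n)))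

        x∈seq : ∀ {i j} → i ℕ.<′ j → x i ∈ seq j
        x∈seq {i} ℕ.<′-base           = subst (x i ∈_) (sym (seq-suc i)) (here refl)
        x∈seq {i} (ℕ.<′-step {n} i<n) = subst (x i ∈_) (sym (seq-suc n)) (there (x∈seq i<n))

        contradict : ¬ (∃₂ λ i j → (i ℕ.< j) × (x i ≲ x j))
        contradict (i , j , i<j , xᵢ≲xⱼ)
          with subst (AllPairs Incomparable) (seq-suc j) (proj₂ (proj₁ (path (suc j))))
        ... | xⱼ⊥ AllPairs.∷ _ = proj₂ (All.lookup xⱼ⊥ (x∈seq (ℕ.<⇒<′ i<j))) xᵢ≲xⱼ

𝐰 : Classical → (A : Preorder c ℓ₁ ℓ₂) → IsWQO A → Ord (c ⊔ ℓ₂)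
𝐰 em A wqo = Inco.rank A (Inco.root-acc A em wqo)

Γ : ℕ → Preorder 0ℓ 0ℓ 0ℓ
Γ k = ≡.preorder (Fin k)

Γ-wqo : ∀ k → IsWQO (Γ k)
Γ-wqo k x with pigeonhole (ℕ.n<1+n k) (x ∘ toℕ)
... | i , j , i<j , eq = toℕ i , toℕ j , i<j , eq

-- A finite subset is given by a list enumerating it, two lists being equal
-- when they have the same members.
module Hoare (A : Preorder c ℓ₁ ℓ₂) where
  open Preorder A using (Carrier; _≲_; module Eq) renaming (refl to ≲-refl; trans to ≲-trans)
  open Membership Eq.setoid using (_∈_)
  open Subset Eq.setoid using (_⊆_)

  infix 4 _≤ᴴ_

  _≤ᴴ_ : List Carrier → List Carrier → Set (c ⊔ ℓ₁ ⊔ ℓ₂)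
  S ≤ᴴ S′ = ∀ a → a ∈ S → ∃ λ b → (b ∈ S′) × (a ≲ b)

  𝒫f-preorder : Preorder c (c ⊔ ℓ₁) (c ⊔ ℓ₁ ⊔ ℓ₂)
  𝒫f-preorder = record
    { Carrier    = List Carrier
    ; _≈_        = λ S S′ → (S ⊆ S′) × (S′ ⊆ S)
    ; _≲_        = _≤ᴴ_
    ; isPreorder = record
      { isEquivalence = record
        { refl  = id , id
        ; sym   = λ (p , q) → q , p
        ; trans = λ (p , q) (p′ , q′) → (λ z → p′ (p z)) , (λ z → q (q′ z))
        }
      ; reflexive = λ (p , _) a a∈S → a , p a∈S , ≲-refl
      ; trans     = λ p q a a∈S →
          let b , b∈S′ , a≲b = p a a∈S
              d , d∈S″ , b≲d = q b b∈S′
          in  d , d∈S″ , ≲-trans a≲b b≲d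
      }
    }

𝒫f : Preorder c ℓ₁ ℓ₂ → Preorder c (c ⊔ ℓ₁) (c ⊔ ℓ₁ ⊔ ℓ₂)
𝒫f A = Hoare.𝒫f-preorder A

-- From a bad sequence S of finite sets, pick a ∈ S₀ that is below no member
-- of Sₙ for infinitely many n ≥ 1 (S₀ is finite), restrict to those n, and
-- repeat; the elements picked form a bad sequence of A.
module _ (em : Classical) (A : Preorder c ℓ₁ ℓ₂) (wqo : IsWQO A) where
  open Preorder A using (Carrier; _≲_; module Eq; ≲-respˡ-≈)
  open Membership Eq.setoid using (_∈_)
  open Hoare A using (_≤ᴴ_)

  private

    Avoids : Carrier → List Carrier → Set (c ⊔ ℓ₁ ⊔ ℓ₂)
    Avoids a S = ¬ (∃ λ b → (b ∈ S) × (a ≲ b))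

    InfinitelyOften : (ℕ → Set ℓ) → Set ℓ
    InfinitelyOften P = ∀ N → ∃ λ n → (N ℕ.≤ n) × P n

    avoided : (S : List Carrier) (T : ℕ → List Carrier) → (∀ n → ¬ (S ≤ᴴ T n)) →
              ∃ λ a → (a ∈ S) × InfinitelyOften (λ n → Avoids a (T n))
    avoided []      T bad = contradiction (λ _ ()) (bad 0)
    avoided (x ∷ S) T bad with em {P = InfinitelyOften (λ n → Avoids x (T n))}
    ... | yes inf = x , here Eq.refl , inf
    ... | no ¬inf = a , there a∈S , inf
      where
      bound : ∃ λ N → ¬ (∃ λ n → (N ℕ.≤ n) × Avoids x (T n))
      bound = decidable-stable em λ ¬N →
        ¬inf λ N → decidable-stable em λ ¬n → ¬N (N , ¬n)

      N : ℕ
      N = proj₁ bound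

      bad′ : ∀ n → ¬ (S ≤ᴴ T (N ℕ.+ n))
      bad′ n S≤T with em {P = ∃ λ b → (b ∈ T (N ℕ.+ n)) × (x ≲ b)}
      ... | no ¬b = proj₂ bound (N ℕ.+ n , ℕ.m≤m+n N n , ¬b)
      ... | yes (b , b∈T , x≲b) = bad (N ℕ.+ n) λ where
        _ (here a≈x)  → b , b∈T , ≲-respˡ-≈ (Eq.sym a≈x) x≲b
        a (there a∈S) → S≤T a a∈S

      rest : ∃ λ a → (a ∈ S) × InfinitelyOften (λ n → Avoids a (T (N ℕ.+ n)))
      rest = avoided S (λ n → T (N ℕ.+ n)) bad′

      a : Carrier
      a = proj₁ rest

      a∈S : a ∈ S
      a∈S = proj₁ (proj₂ rest)

      inf : InfinitelyOften (λ n → Avoids a (T n))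
      inf M = let n , M≤n , av = proj₂ (proj₂ rest) M
              in  N ℕ.+ n , ℕ.≤-trans M≤n (ℕ.m≤n+m n N) , av

    BadSeq : Set (c ⊔ ℓ₁ ⊔ ℓ₂)
    BadSeq = ∃ λ (T : ℕ → List Carrier) → ∀ {i j} → i ℕ.< j → ¬ (T i ≤ᴴ T j)

    module Next (s : BadSeq) where

      T : ℕ → List Carrier
      T = proj₁ s

      bad : ∀ {i j} → i ℕ.< j → ¬ (T i ≤ᴴ T j)
      bad = proj₂ s

      choice : ∃ λ a → (a ∈ T 0) × InfinitelyOften (λ n → Avoids a (T (suc n)))
      choice = avoided (T 0) (T ∘ suc) (λ n → bad ℕ.z<s)

      a : Carrier
      a = proj₁ choice

      hit : ∀ N → ∃ λ n → (N ℕ.≤ n) × Avoids a (T (suc n))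
      hit = proj₂ (proj₂ choice)

      index : ℕ → ℕ
      index zero    = proj₁ (hit 0)
      index (suc n) = proj₁ (hit (suc (index n)))

      index-mono : ∀ {i j} → i ℕ.<′ j → index i ℕ.< index j
      index-mono {i} ℕ.<′-base           = proj₁ (proj₂ (hit (suc (index i))))
      index-mono     (ℕ.<′-step {n} i<n) =
        ℕ.<-trans (index-mono i<n) (proj₁ (proj₂ (hit (suc (index n)))))

      next : BadSeq
      next = T ∘ suc ∘ index , λ i<j → bad (ℕ.s<s (index-mono (ℕ.<⇒<′ i<j)))

      next-avoids : ∀ n → Avoids a (proj₁ next n)
      next-avoids zero    = proj₂ (proj₂ (hit 0))
      next-avoids (suc n) = proj₂ (proj₂ (hit (suc (index n))))

  𝒫f-wqo : IsWQO (𝒫f A)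
  𝒫f-wqo S = decidable-stable em λ ¬good →
    let bads : ℕ → BadSeq
        bads = λ n → iter (S , λ i<j Sᵢ≤Sⱼ → ¬good (_ , _ , i<j , Sᵢ≤Sⱼ)) n
        i , j , i<j , xᵢ≲xⱼ = wqo (λ n → Next.a (bads n))
        k , eq = later _ (ℕ.<⇒<′ i<j) 0
    in  Next.next-avoids (bads i) k
          (_ , subst (Next.a (bads j) ∈_) eq (proj₁ (proj₂ (Next.choice (bads j)))) , xᵢ≲xⱼ)
    where
    iter : BadSeq → ℕ → BadSeq
    iter s zero    = s
    iter s (suc n) = Next.next (iter s n)

    later : ∀ s {i j} → i ℕ.<′ j → ∀ n →
            ∃ λ k → proj₁ (iter s j) n ≡ proj₁ (iter s (suc i)) k
    later s ℕ.<′-base           n = n , refl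
    later s (ℕ.<′-step {m} i<m) n = later s i<m (suc (Next.index (iter s m) n))

-- Reserving an antichain x₁, …, xₙ of A, with B the set of elements
-- incomparable to all xᵢ, embeds 𝒫f(B) × 2ⁿ in 𝒫f(A) as the sets S ∪ X with
-- S ⊆ B and X ⊆ {x₁, …, xₙ}.  For w(B) ≥ β with β a limit, δ = 2^β is closed
-- under the natural sum, so the subsets of 𝒫f(B) of width below δ form an
-- ideal.  Below a minimal S whose down-set is not in the ideal there is a part
-- N of 𝒫f(B) outside the ideal all of whose principal down-sets are in it.
-- Hence an antichain sequence played in N can always be followed by one of
-- rank δ avoiding everything below the earlier elements; ordering the 2ⁿ sets
-- X so that none is contained in a later one, this gives width at least
-- δ · 2ⁿ = 2^(β + n).  Successor steps reserve one more element.

module Submission where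

open import Defs
open import Data.Nat.Base using (ℕ)
open import Data.Product.Base using (_×_)
open import Relation.Binary.Bundles using (Preorder)

open import Data.Fin.Base using (Fin; zero; suc)
open import Data.List.Base using (List; []; _∷_; _++_; map; length)
open import Data.List.Properties using (++-assoc; length-++; length-map)
open import Data.List.Membership.Propositional using (_∈_)
import Data.List.Membership.Setoid as Membership
open import Data.List.Membership.Propositional.Properties using (∈-++⁻; ∈-map⁻)
open import Data.List.Relation.Unary.All as All using (All; []; _∷_)
import Data.List.Relation.Unary.All.Properties as All
open import Data.List.Relation.Unary.AllPairs as AllPairs using (AllPairs; []; _∷_)
import Data.List.Relation.Unary.AllPairs.Properties as AllPairs
open import Data.List.Relation.Unary.Any as Any using (Any; here; there)
import Data.List.Relation.Unary.Any.Properties as Any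
open import Data.Maybe.Base using (Maybe; just; nothing; maybe′)
open import Data.Nat.Base as ℕ using (zero; suc)
import Data.Nat.Properties as ℕ
open import Data.Product.Base using (∃; _,_; proj₁; proj₂; swap)
open import Data.Sum.Base using (_⊎_; inj₁; inj₂; [_,_]; [_,_]′; fromInj₁; fromInj₂; map₁; map₂)
open import Data.Unit.Polymorphic using (tt)
open import Function.Base using (_∘_; id)
open import Induction.WellFounded using (Acc; acc)
open import Level using (Level; _⊔_)
open import Relation.Binary.PropositionalEquality.Core using (_≡_; refl; sym; trans; cong; cong₂; subst)
open import Relation.Nullary.Decidable.Core using (yes; no; decidable-stable)
open import Relation.Nullary.Negation.Core using (¬_; contradiction)

private
  variable
    p q r c ℓ ℓ₁ ℓ₂ c′ ℓ₁′ ℓ₂′ : Level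

-- Ordinals

infix 4 _<_

_<_ : Ord p → Ord q → Set (p ⊔ q)
α < β = ∃ λ k → α ≤ branch β k

≤-refl : (α : Ord p) → α ≤ α
≤-refl (sup⁺ I f) i = i , ≤-refl (f i)

≤-trans : (α : Ord p) (β : Ord q) (γ : Ord r) → α ≤ β → β ≤ γ → α ≤ γ
≤-trans (sup⁺ I f) (sup⁺ J g) (sup⁺ K h) α≤β β≤γ i =
  let j , fi≤gj = α≤β i
      k , gj≤hk = β≤γ j
  in  k , ≤-trans (f i) (g j) (h k) fi≤gj gj≤hk

≤-branch : (α : Ord p) (β : Ord q) → α ≤ β → ∀ k → branch α k < β
≤-branch (sup⁺ I f) (sup⁺ J g) α≤β = α≤β

branches-≤ : (α : Ord p) (β : Ord q) → (∀ k → branch α k < β) → α ≤ β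
branches-≤ (sup⁺ I f) (sup⁺ J g) α<β = α<β

≤-<-trans : (α : Ord p) (β : Ord q) (γ : Ord r) → α ≤ β → β < γ → α < γ
≤-<-trans α β γ α≤β (k , β≤) = k , ≤-trans α β (branch γ k) α≤β β≤

<-≤-trans : (α : Ord p) (β : Ord q) (γ : Ord r) → α < β → β ≤ γ → α < γ
<-≤-trans α β γ (k , α≤) β≤γ = ≤-<-trans α (branch β k) γ α≤ (≤-branch β γ β≤γ k)

<⇒≤ : (α : Ord p) (β : Ord q) → α < β → α ≤ β
<⇒≤ (sup⁺ I f) (sup⁺ J g) (k , α≤) i =
  k , <⇒≤ (f i) (g k) (≤-branch (sup⁺ I f) (g k) α≤ i)

≰-branch : (α : Ord p) → ∀ k → ¬ (α ≤ branch α k)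
≰-branch (sup⁺ I f) i α≤fi =
  let k , fi≤ = ≤-branch (sup⁺ I f) (f i) α≤fi i
  in  ≰-branch (f i) k fi≤

-- If `α < β` fails, no branch of `β` is above `α`, and the recursive call with the arguments
-- exchanged puts every branch of `β` strictly below `α`.
<⊎≥ : Classical → (α : Ord p) (β : Ord q) → (α < β) ⊎ (β ≤ α)
<⊎≥ em α (sup⁺ J g) with em {P = α < sup⁺ J g}
... | yes α<β = inj₁ α<β
... | no  α≮β = inj₂ (branches-≤ (sup⁺ J g) α λ j →
  fromInj₁ (λ α≤gj → contradiction (j , α≤gj) α≮β) (<⊎≥ em (g j) α))

ω≤-or-finite : Classical → (α : Ord p) → (ω ≤ α) ⊎ ∃ λ n → α ≤ fromℕ n
ω≤-or-finite em α with em {P = ∃ λ n → α ≤ fromℕ n}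
... | yes fin = inj₂ fin
... | no ¬fin = inj₁ (branches-≤ ω α λ n →
  fromInj₁ (λ α≤n → contradiction (n , α≤n) ¬fin) (<⊎≥ em (fromℕ n) α))

infixl 6 _⊞_

-- The Hessenberg natural sum.
_⊞_ : Ord ℓ → Ord ℓ → Ord ℓ
sup⁺ I f ⊞ sup⁺ J g =
  sup⁺ (I ⊎ J) [ (λ i → f i ⊞ sup⁺ J g) , (λ j → sup⁺ I f ⊞ g j) ]

⊞-mono : (α β : Ord p) (γ δ : Ord q) → α ≤ γ → β ≤ δ → α ⊞ β ≤ γ ⊞ δ
⊞-mono (sup⁺ I f) β@(sup⁺ J g) (sup⁺ K h) δ@(sup⁺ L m) α≤γ β≤δ (inj₁ i) =
  let k , le = α≤γ i in inj₁ k , ⊞-mono (f i) β (h k) δ le β≤δ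
⊞-mono α@(sup⁺ I f) (sup⁺ J g) γ@(sup⁺ K h) (sup⁺ L m) α≤γ β≤δ (inj₂ j) =
  let l , le = β≤δ j in inj₂ l , ⊞-mono α (g j) γ (m l) α≤γ le

<-⊞-≤ : (α β γ δ : Ord ℓ) → α < γ → β ≤ δ → α ⊞ β < γ ⊞ δ
<-⊞-≤ α β (sup⁺ K h) (sup⁺ L m) (k , α≤) β≤δ =
  inj₁ k , ⊞-mono α β (h k) (sup⁺ L m) α≤ β≤δ

≤-⊞ : (α β : Ord ℓ) → α ≤ α ⊞ β
≤-⊞ (sup⁺ I f) (sup⁺ J g) i = inj₁ i , ≤-⊞ (f i) (sup⁺ J g)

≤-⊞ʳ : (α β : Ord ℓ) → β ≤ α ⊞ β
≤-⊞ʳ (sup⁺ I f) (sup⁺ J g) j = inj₂ j , ≤-⊞ʳ (sup⁺ I f) (g j)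

≤-+ʳ : (α β : Ord ℓ) → β ≤ α + β
≤-+ʳ α (sup⁺ J g) j = inj₂ j , ≤-+ʳ α (g j)

+≤⊞ : (α β γ δ : Ord ℓ) → α ≤ γ → β ≤ δ → α + β ≤ γ ⊞ δ
+≤⊞ α β@(sup⁺ J g) γ@(sup⁺ K h) δ@(sup⁺ L m) α≤γ β≤δ (inj₁ i) =
  let k , le = ≤-branch α γ α≤γ i
  in  inj₁ k , ≤-trans (branch α i) (h k) (h k ⊞ δ) le (≤-⊞ (h k) δ)
+≤⊞ α (sup⁺ J g) γ@(sup⁺ K h) (sup⁺ L m) α≤γ β≤δ (inj₂ j) =
  let l , le = β≤δ j in inj₂ l , +≤⊞ α (g j) γ (m l) α≤γ le

+-monoʳ : (α β γ : Ord ℓ) → β ≤ γ → α + β ≤ α + γ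
+-monoʳ α (sup⁺ J g) (sup⁺ K h) β≤γ (inj₁ i) = inj₁ i , ≤-refl (branch α i)
+-monoʳ α (sup⁺ J g) (sup⁺ K h) β≤γ (inj₂ j) =
  let k , le = β≤γ j in inj₂ k , +-monoʳ α (g j) (h k) le

fromℕ-⊞ : ∀ m n → fromℕ m ⊞ fromℕ n ≤ fromℕ (m ℕ.+ n)
fromℕ-⊞ zero    zero    (inj₁ ())
fromℕ-⊞ zero    zero    (inj₂ ())
fromℕ-⊞ zero    (suc n) (inj₂ _) = tt , fromℕ-⊞ zero n
fromℕ-⊞ (suc m) zero    (inj₁ _) = tt , fromℕ-⊞ m zero
fromℕ-⊞ (suc m) (suc n) (inj₁ _) = tt , fromℕ-⊞ m (suc n)
fromℕ-⊞ (suc m) (suc n) (inj₂ _) rewrite ℕ.+-suc m n = tt , fromℕ-⊞ (suc m) n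

-- 2^ with the natural sum in place of _+_; at limits it is visibly closed
-- under _⊞_.
E : Ord ℓ → Ord ℓ
E (sup⁺ I f) = ⨆ (Maybe I) (maybe′ (λ i → E (f i) ⊞ E (f i)) (𝟎 +1))

2^≤E : (α : Ord ℓ) → 2^ α ≤ E α
2^≤E (sup⁺ I f) (nothing , k) = (nothing , k) , λ ()
2^≤E (sup⁺ I f) (just i , k)  =
  let le    = 2^≤E (f i)
      l , t = ≤-branch (2^ f i + 2^ f i) (E (f i) ⊞ E (f i))
                (+≤⊞ (2^ f i) (2^ f i) (E (f i)) (E (f i)) le le) k
  in  (just i , l) , t

0<E : (α : Ord p) → 𝟎 {q} < E α
0<E (sup⁺ I f) = (nothing , tt) , λ ()

E-mono : (α : Ord p) (β : Ord q) → α ≤ β → E α ≤ E β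
E-mono (sup⁺ I f) (sup⁺ J g) α≤β (nothing , k) = (nothing , tt) , λ ()
E-mono (sup⁺ I f) (sup⁺ J g) α≤β (just i , k)  =
  let j , fi≤gj = α≤β i
      le    = E-mono (f i) (g j) fi≤gj
      l , t = ≤-branch (E (f i) ⊞ E (f i)) (E (g j) ⊞ E (g j))
                (⊞-mono (E (f i)) (E (f i)) (E (g j)) (E (g j)) le le) k
  in  (just j , l) , t

E-suc : (α : Ord p) (β : Ord q) → α ≤ β +1 → E α ≤ E β ⊞ E β
E-suc α β α≤β+1 = ≤-trans (E α) (E (β +1)) (E β ⊞ E β) (E-mono α (β +1) α≤β+1) E+1
  where
  E+1 : E (β +1) ≤ E β ⊞ E β
  E+1 = branches-≤ (E (β +1)) (E β ⊞ E β) λ where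
    (nothing , _) → <-≤-trans 𝟎 (E β) (E β ⊞ E β) (0<E β) (≤-⊞ (E β) (E β))
    (just _ , k)  → k , ≤-refl (branch (E β ⊞ E β) k)

E-< : (α : Ord p) (β : Ord q) → α < β → E α ⊞ E α ≤ E β
E-< α (sup⁺ J g) (j , α≤gj) = branches-≤ (E α ⊞ E α) (E (sup⁺ J g)) λ k →
  let le    = E-mono α (g j) α≤gj
      l , t = ≤-branch (E α ⊞ E α) (E (g j) ⊞ E (g j))
                (⊞-mono (E α) (E α) (E (g j)) (E (g j)) le le) k
  in  (just j , l) , t

-- Each successor doubles, and doubling keeps finite ordinals finite. This serves the finite
-- branches of a limit in `growth`.
E-finite : ∀ n → ∃ λ m → E (fromℕ n) ≤ fromℕ m
E-finite zero    = 1 , λ { (nothing , _) → tt , λ () ; (just () , _) }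
E-finite (suc n) =
  let m , le = E-finite n
      two    = E (fromℕ n) ⊞ E (fromℕ n)
      2E≤    = ≤-trans two (fromℕ m ⊞ fromℕ m) (fromℕ (m ℕ.+ m))
                 (⊞-mono (E (fromℕ n)) (E (fromℕ n)) (fromℕ m) (fromℕ m) le le)
                 (fromℕ-⊞ m m)
  in  m ℕ.+ m , ≤-trans (E (fromℕ (suc n))) two (fromℕ (m ℕ.+ m))
                  (E-suc (fromℕ (suc n)) (fromℕ n) (≤-refl (fromℕ (suc n)))) 2E≤

fromℕ≤ω : ∀ n → fromℕ n ≤ ω
fromℕ≤ω zero    ()
fromℕ≤ω (suc n) _ = n , ≤-refl (fromℕ n)

-- The natural product of `α` with the number 2ⁿ, built by doubling to match the recursion of `E` at
-- successors.
2^_·_ : ℕ → Ord ℓ → Ord ℓ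
2^ zero  · α = α
2^ suc n · α = (2^ n · α) ⊞ (2^ n · α)

2^·-mono : ∀ n (α β : Ord ℓ) → α ≤ β → 2^ n · α ≤ 2^ n · β
2^·-mono zero    α β α≤β = α≤β
2^·-mono (suc n) α β α≤β =
  let le = 2^·-mono n α β α≤β
  in  ⊞-mono (2^ n · α) (2^ n · α) (2^ n · β) (2^ n · β) le le

2^·-⊞ : ∀ n (α : Ord ℓ) → 2^ n · (α ⊞ α) ≡ 2^ suc n · α
2^·-⊞ zero    α = refl
2^·-⊞ (suc n) α = cong₂ _⊞_ (2^·-⊞ n α) (2^·-⊞ n α)

-- Additively indecomposable ordinals

⊞-Closed : Ord ℓ → Set ℓ
⊞-Closed δ = ∀ k l → branch δ k ⊞ branch δ l < δ

module Limit (em : Classical) (I : Set ℓ) (f : I → Ord ℓ) (i₀ : I)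
             (limit : ∀ i → ∃ λ j → f i < f j) where

  private
    δ : Ord ℓ
    δ = E (sup⁺ I f)

  -- At a limit the doubling in a branch of `δ` is absorbed by passing to a larger exponent, so the
  -- `E (f i)` are cofinal in `δ`.
  E-branch-< : ∀ k → ∃ λ i → branch δ k < E (f i)
  E-branch-< (nothing , _) = i₀ , 0<E (f i₀)
  E-branch-< (just i , k)  =
    let j , fi<fj = limit i
    in  j , ≤-branch (E (f i) ⊞ E (f i)) (E (f j)) (E-< (f i) (f j) fi<fj) k

  -- As exponents are comparable, both branches lie below a single `E (f i)`; their sum is then
  -- below `E (f i) ⊞ E (f i)`, whose branches are branches of `δ`.
  E-closed : ⊞-Closed δ
  E-closed k l =
    let i , k< = E-branch-< k
        j , l< = E-branch-< l
    in  [ (λ fi<fj → within j (raise i j k< (<⇒≤ (f i) (f j) fi<fj)) l<)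
        , (λ fj≤fi → within i k< (raise j i l< fj≤fi)) ]′ (<⊎≥ em (f i) (f j))
    where
    raise : ∀ {α : Ord ℓ} i j → α < E (f i) → f i ≤ f j → α < E (f j)
    raise {α} i j α< fi≤fj = <-≤-trans α (E (f i)) (E (f j)) α< (E-mono (f i) (f j) fi≤fj)

    within : ∀ i → branch δ k < E (f i) → branch δ l < E (f i) → branch δ k ⊞ branch δ l < δ
    within i k< l< =
      let m , le = <-⊞-≤ (branch δ k) (branch δ l) (E (f i)) (E (f i))
                     k< (<⇒≤ (branch δ l) (E (f i)) l<)
      in  (just i , m) , le

  -- Lets `tame-large` count a single equivalence class, of width at most 1, as small.
  1<E : 𝟎 {ℓ} +1 < δ
  1<E =
    let 1≤      = ≤-trans (𝟎 +1) (E (f i₀)) (𝟎 ⊞ E (f i₀))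
                    (branches-≤ (𝟎 +1) (E (f i₀)) λ _ → 0<E (f i₀)) (≤-⊞ʳ 𝟎 (E (f i₀)))
        k , lt  = ≤-<-trans (𝟎 +1) (𝟎 ⊞ E (f i₀)) (E (f i₀) ⊞ E (f i₀)) 1≤
                    (<-⊞-≤ 𝟎 (E (f i₀)) (E (f i₀)) (E (f i₀)) (0<E (f i₀)) (≤-refl (E (f i₀))))
    in  (just i₀ , k) , lt

module Multiples (I : Set ℓ) (f : I → Ord ℓ) (closed : ⊞-Closed (sup⁺ I f)) where

  δ : Ord ℓ
  δ = sup⁺ I f

  δ· : ℕ → Ord ℓ
  δ· zero    = 𝟎
  δ· (suc n) = δ· n + δ

  private
    -- The sum of the remainders stays below δ and hence costs less than the
    -- multiple of δ given up by passing to a smaller m or n.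
    absorb : ∀ m n → (σ ρ : Ord ℓ) → σ < δ → ρ < δ →
             (δ· m + σ) ⊞ (δ· n + ρ) ≤ δ· (m ℕ.+ n) + (σ ⊞ ρ)

    absorbˡ : ∀ m n (ρ : Ord ℓ) → ρ < δ → ∀ k →
              branch (δ· m) k ⊞ (δ· n + ρ) < δ· (m ℕ.+ n)

    absorbʳ : ∀ m n (σ : Ord ℓ) → σ < δ → ∀ k →
              (δ· m + σ) ⊞ branch (δ· n) k < δ· (m ℕ.+ n)

    below : ∀ n (σ ρ : Ord ℓ) → σ < δ → ρ < δ → (δ· n + (σ ⊞ ρ)) < δ· (suc n)
    below n σ ρ (k , σ≤) (l , ρ≤) =
      let m , le = closed k l
      in  inj₂ m , +-monoʳ (δ· n) (σ ⊞ ρ) (f m)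
                     (≤-trans (σ ⊞ ρ) (f k ⊞ f l) (f m) (⊞-mono σ ρ (f k) (f l) σ≤ ρ≤) le)

    <δ-branch : (σ : Ord ℓ) → σ < δ → ∀ k → branch σ k < δ
    <δ-branch σ σ<δ k = <-≤-trans (branch σ k) σ δ (k , ≤-refl (branch σ k)) (<⇒≤ σ δ σ<δ)

    absorb m n σ@(sup⁺ K g) ρ@(sup⁺ L h) σ<δ ρ<δ (inj₁ (inj₁ k)) =
      let j , le = absorbˡ m n ρ ρ<δ k in inj₁ j , le
    absorb m n σ@(sup⁺ K g) ρ@(sup⁺ L h) σ<δ ρ<δ (inj₁ (inj₂ k)) =
      inj₂ (inj₁ k) , absorb m n (g k) ρ (<δ-branch σ σ<δ k) ρ<δ
    absorb m n σ@(sup⁺ K g) ρ@(sup⁺ L h) σ<δ ρ<δ (inj₂ (inj₁ l)) =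
      let j , le = absorbʳ m n σ σ<δ l in inj₁ j , le
    absorb m n σ@(sup⁺ K g) ρ@(sup⁺ L h) σ<δ ρ<δ (inj₂ (inj₂ l)) =
      inj₂ (inj₂ l) , absorb m n σ (h l) σ<δ (<δ-branch ρ ρ<δ l)

    absorbˡ zero    n ρ ρ<δ ()
    absorbˡ (suc m) n ρ ρ<δ (inj₁ k) = let j , le = absorbˡ m n ρ ρ<δ k in inj₁ j , le
    absorbˡ (suc m) n ρ ρ<δ (inj₂ k) =
      ≤-<-trans ((δ· m + f k) ⊞ (δ· n + ρ)) (δ· (m ℕ.+ n) + (f k ⊞ ρ)) (δ· (suc m ℕ.+ n))
        (absorb m n (f k) ρ (k , ≤-refl (f k)) ρ<δ)
        (below (m ℕ.+ n) (f k) ρ (k , ≤-refl (f k)) ρ<δ)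

    absorbʳ m zero    σ σ<δ ()
    absorbʳ m (suc n) σ σ<δ k rewrite ℕ.+-suc m n with k
    ... | inj₁ k = let j , le = absorbʳ m n σ σ<δ k in inj₁ j , le
    ... | inj₂ k =
      ≤-<-trans ((δ· m + σ) ⊞ (δ· n + f k)) (δ· (m ℕ.+ n) + (σ ⊞ f k)) (δ· (suc (m ℕ.+ n)))
        (absorb m n σ (f k) σ<δ (k , ≤-refl (f k)))
        (below (m ℕ.+ n) σ (f k) σ<δ (k , ≤-refl (f k)))

  -- This is `absorb` with both remainders zero. It trades the natural multiples of `δ` asked for by
  -- `growth` for the ordinary ones realised by `phases`.
  δ·-⊞ : 𝟎 {ℓ} < δ → ∀ m n → δ· m ⊞ δ· n ≤ δ· (m ℕ.+ n)
  δ·-⊞ 0<δ m n =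
    ≤-trans (δ· m ⊞ δ· n) ((δ· m + 𝟎) ⊞ (δ· n + 𝟎)) (δ· (m ℕ.+ n))
      (⊞-mono (δ· m) (δ· n) (δ· m + 𝟎) (δ· n + 𝟎) (≤+𝟎 (δ· m)) (≤+𝟎 (δ· n)))
    (≤-trans ((δ· m + 𝟎) ⊞ (δ· n + 𝟎)) (δ· (m ℕ.+ n) + (𝟎 ⊞ 𝟎)) (δ· (m ℕ.+ n))
      (absorb m n 𝟎 𝟎 0<δ 0<δ)
      (branches-≤ (δ· (m ℕ.+ n) + (𝟎 ⊞ 𝟎)) (δ· (m ℕ.+ n)) λ where
        (inj₁ k)         → k , ≤-refl (branch (δ· (m ℕ.+ n)) k)
        (inj₂ (inj₁ ()))
        (inj₂ (inj₂ ()))))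
    where
    ≤+𝟎 : (α : Ord ℓ) → α ≤ α + 𝟎
    ≤+𝟎 α@(sup⁺ K g) k = inj₁ k , ≤-refl (g k)

-- Widths of subsets

module Width (A : Preorder c ℓ₁ ℓ₂) where
  open Preorder A using (Carrier; _≲_)
  open Inco A using (Incomparable; Node; rank; _IsChildOf_)

  infixl 7 _∥_ _∥*_

  _∥_ : (Carrier → Set p) → Carrier → Carrier → Set (p ⊔ ℓ₂)
  (X ∥ x) y = X y × Incomparable y x

  _∥*_ : (Carrier → Set p) → List Carrier → Carrier → Set (c ⊔ p ⊔ ℓ₂)
  (X ∥* s) y = X y × All (Incomparable y) s

  -- A strategy form of the rank in `Inco`, by recursion on the ordinal instead of on accessibility,
  -- so that it applies to every part X of a preorder.
  Width≥ : (Carrier → Set p) → Ord q → Set (c ⊔ p ⊔ ℓ₂ ⊔ q)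
  Width≥ X (sup⁺ J g) = ∀ j → ∃ λ x → X x × Width≥ (X ∥ x) (g j)

  Width≤ : (Carrier → Set p) → Ord q → Set (c ⊔ p ⊔ ℓ₂ ⊔ q)
  Width≤ X (sup⁺ J g) = ∀ x → X x → ∃ λ j → Width≤ (X ∥ x) (g j)

  ≥-branch : (X : Carrier → Set p) (α : Ord q) → Width≥ X α →
             ∀ k → ∃ λ x → X x × Width≥ (X ∥ x) (branch α k)
  ≥-branch X (sup⁺ J g) w = w

  ≥-mono : (X : Carrier → Set p) (Y : Carrier → Set q) (α : Ord r) (β : Ord ℓ) →
           (∀ {x} → X x → Y x) → β ≤ α → Width≥ X α → Width≥ Y β
  ≥-mono X Y (sup⁺ I f) (sup⁺ J g) X⊆Y β≤α w j =
    let i , gj≤fi  = β≤α j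
        x , Xx , v = w i
    in  x , X⊆Y Xx , ≥-mono (X ∥ x) (Y ∥ x) (f i) (g j) (λ (Xy , y∥x) → X⊆Y Xy , y∥x) gj≤fi v

  ≥-⊆ : (X : Carrier → Set p) (Y : Carrier → Set q) (α : Ord r) →
        (∀ {x} → X x → Y x) → Width≥ X α → Width≥ Y α
  ≥-⊆ X Y α X⊆Y = ≥-mono X Y α α X⊆Y (≤-refl α)

  ≤-mono : (X : Carrier → Set p) (Y : Carrier → Set q) (α : Ord r) (β : Ord ℓ) →
           (∀ {x} → Y x → X x) → α ≤ β → Width≤ X α → Width≤ Y β
  ≤-mono X Y (sup⁺ I f) (sup⁺ J g) Y⊆X α≤β w y Yy =
    let i , v     = w y (Y⊆X Yy)
        j , fi≤gj = α≤β i
    in  j , ≤-mono (X ∥ y) (Y ∥ y) (f i) (g j) (λ (Yz , z∥y) → Y⊆X Yz , z∥y) fi≤gj v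

  -- The moves supplied by the lower bound are fed to the upper bound, and both ordinals descend
  -- together.
  ≥⇒≤⇒≤ : (X : Carrier → Set p) (α : Ord q) (β : Ord r) →
           Width≥ X α → Width≤ X β → α ≤ β
  ≥⇒≤⇒≤ X (sup⁺ I f) (sup⁺ J g) w v i =
    let x , Xx , w′ = w i
        j , v′      = v x Xx
    in  j , ≥⇒≤⇒≤ (X ∥ x) (f i) (g j) w′ v′

  -- Each element played lies in X or in Y and lowers the summand of that part. The two parts may be
  -- played in any interleaving, hence the natural sum.
  ≤-∪ : (X : Carrier → Set p) (Y : Carrier → Set q) (Z : Carrier → Set r) (α β : Ord ℓ) →
        (∀ {z} → Z z → X z ⊎ Y z) → Width≤ X α → Width≤ Y β → Width≤ Z (α ⊞ β)
  ≤-∪ X Y Z α@(sup⁺ I f) β@(sup⁺ J g) Z⊆X∪Y w v z Zz =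
    [ (λ Xz →
        let i , w′ = w z Xz
        in  inj₁ i , ≤-∪ (X ∥ z) Y (Z ∥ z) (f i) β
              (λ (Zy , y∥z) → map₁ (_, y∥z) (Z⊆X∪Y Zy)) w′ v)
    , (λ Yz →
        let j , v′ = v z Yz
        in  inj₂ j , ≤-∪ X (Y ∥ z) (Z ∥ z) α (g j)
              (λ (Zy , y∥z) → map₂ (_, y∥z) (Z⊆X∪Y Zy)) w v′)
    ] (Z⊆X∪Y Zz)

  -- If no x leaves width `α`, each `X ∥ x` is bounded by some branch of `α`: otherwise the
  -- recursive calls would give it a move for every branch, which is width `α`.
  >⊎≤ : Classical → (X : Carrier → Set p) (α : Ord q) →
        (∃ λ x → X x × Width≥ (X ∥ x) α) ⊎ Width≤ X α
  >⊎≤ em X (sup⁺ I f) with em {P = ∃ λ x → X x × Width≥ (X ∥ x) (sup⁺ I f)}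
  ... | yes w = inj₁ w
  ... | no ¬w = inj₂ λ x Xx → decidable-stable em λ ¬v → ¬w (x , Xx , λ i →
    fromInj₁ (λ v → contradiction (i , v) ¬v) (>⊎≤ em (X ∥ x) (f i)))

  -- A sequence realising β comes first: ranks count down, so α + β is
  -- exhausted from its right summand.
  ≥-+ : (X : Carrier → Set p) (Y : Carrier → Set q) (Z : Carrier → Set r) (α β : Ord ℓ) →
        (∀ {x} → Y x → X x) → (∀ {x} → Z x → X x) →
        Width≥ Y β → (∀ s → All Y s → Width≥ (Z ∥* s) α) → Width≥ X (α + β)
  -- The elements played so far have already been absorbed into X, Y and Z through `_∥_`, so the
  -- second phase starts from the empty sequence.
  ≥-+ X Y Z α (sup⁺ J g) Y⊆X Z⊆X w v (inj₁ k) =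
    ≥-branch X α (≥-⊆ (Z ∥* []) X α (Z⊆X ∘ proj₁) (v [] [])) k
  ≥-+ X Y Z α (sup⁺ J g) Y⊆X Z⊆X w v (inj₂ j) =
    let y , Yy , w′ = w j
    in  y , Y⊆X Yy , ≥-+ (X ∥ y) (Y ∥ y) (Z ∥ y) α (g j)
          (λ (Yx , x∥y) → Y⊆X Yx , x∥y)
          (λ (Zx , x∥y) → Z⊆X Zx , x∥y) w′
          (λ s Ys → ≥-⊆ (Z ∥* (y ∷ s)) ((Z ∥ y) ∥* s) α
            (λ { (Zx , x∥y ∷ x∥s) → (Zx , x∥y) , x∥s })
            (v (y ∷ s) (Yy ∷ All.map proj₁ Ys)))

  Available : Node → Carrier → Set (c ⊔ ℓ₂)
  Available s y = All (Incomparable y) (proj₁ s)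

  -- The available elements are exactly the one-element extensions of the node. With `≥⇒≤rank`, the
  -- rank is the largest `α` satisfying `Width≥`.
  rank-≥ : (s : Node) (a : Acc _IsChildOf_ s) → Width≥ (Available s) (rank a)
  rank-≥ s (acc rs) (((.(x ∷ _) , x∥s ∷ s-anti) , (x , refl)) ) =
    x , x∥s , ≥-⊆ (Available (x ∷ proj₁ s , x∥s ∷ s-anti)) (Available s ∥ x) (rank (rs (x , refl)))
      (λ { (y∥x ∷ y∥s) → y∥s , y∥x }) (rank-≥ _ (rs (x , refl)))

  ≥⇒≤rank : (s : Node) (a : Acc _IsChildOf_ s) (α : Ord q) → Width≥ (Available s) α → α ≤ rank a
  ≥⇒≤rank s (acc rs) (sup⁺ I f) w i =
    let x , x∥s , v = w i
        t = (x ∷ proj₁ s , x∥s ∷ proj₂ s)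
    in  (t , x , refl) , ≥⇒≤rank t (rs (x , refl)) (f i)
          (≥-⊆ (Available s ∥ x) (Available t) (f i) (λ (y∥s , y∥x) → y∥x ∷ y∥s) v)

-- A map that reflects the order sends incomparable elements to incomparable ones, so it carries
-- antichain sequences along.
Width≥-map : (A : Preorder c ℓ₁ ℓ₂) (B : Preorder c′ ℓ₁′ ℓ₂′) →
  let module A = Preorder A ; module B = Preorder B in
  (X : A.Carrier → Set p) (Y : B.Carrier → Set q) (h : A.Carrier → B.Carrier) (α : Ord r) →
  (∀ {x} → X x → Y (h x)) → (∀ {x y} → X x → X y → h x B.≲ h y → x A.≲ y) →
  Width.Width≥ A X α → Width.Width≥ B Y α
Width≥-map A B X Y h (sup⁺ I f) XY reflects w i =
  let x , Xx , v = w i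
  in  h x , XY Xx , Width≥-map A B (X ∥ᴬ x) (Y ∥ᴮ h x) h (f i)
        (λ (Xy , y≴x , x≴y) → XY Xy , y≴x ∘ reflects Xy Xx , x≴y ∘ reflects Xx Xy)
        (λ (Xy , _) (Xz , _) → reflects Xy Xz) v
  where
  open Width A using () renaming (_∥_ to _∥ᴬ_)
  open Width B using () renaming (_∥_ to _∥ᴮ_)

-- Otherwise there is an infinite strictly descending chain, and a good pair i < j in it gives xᵢ ≲
-- xⱼ ≲ xᵢ₊₁, against the strict step at i.
wqo-minimal : Classical → (A : Preorder c ℓ₁ ℓ₂) → IsWQO A →
  let open Preorder A in
  (X : Carrier → Set p) → ∃ X → ∃ λ x → X x × (∀ {y} → X y → y ≲ x → x ≲ y)
wqo-minimal em A wqo X x₀ = decidable-stable em impossible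
  where
  open Preorder A using (_≲_) renaming (refl to ≲-refl; trans to ≲-trans)

  impossible : ¬ ¬ (∃ λ x → X x × (∀ {y} → X y → y ≲ x → x ≲ y))
  impossible none = contradict (wqo (proj₁ ∘ chain))
    where
    descend : (x : ∃ X) → ∃ λ (y : ∃ X) → (proj₁ y ≲ proj₁ x) × ¬ (proj₁ x ≲ proj₁ y)
    descend (x , Xx) = decidable-stable em λ stuck →
      none (x , Xx , λ Xy y≲x → decidable-stable em λ x≴y → stuck ((_ , Xy) , y≲x , x≴y))

    chain : ℕ → ∃ X
    chain zero    = x₀
    chain (suc n) = proj₁ (descend (chain n))

    decreasing : ∀ {i j} → i ℕ.≤′ j → proj₁ (chain j) ≲ proj₁ (chain i)
    decreasing ℕ.≤′-refl                   = ≲-refl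
    decreasing {i} (ℕ.≤′-step {n = n} i≤n) =
      ≲-trans (proj₁ (proj₂ (descend (chain n)))) (decreasing {i} {n} i≤n)

    contradict : ¬ (∃ λ i → ∃ λ j → (i ℕ.< j) × (proj₁ (chain i) ≲ proj₁ (chain j)))
    contradict (i , j , i<j , xᵢ≲xⱼ) =
      proj₂ (proj₂ (descend (chain i))) (≲-trans xᵢ≲xⱼ (decreasing {suc i} {j} (ℕ.≤⇒≤′ i<j)))

-- The ideal of sets of width below δ

module Ideal (em : Classical) (A : Preorder c ℓ₁ ℓ₂) (I : Set ℓ) (f : I → Ord ℓ)
             (closed : ⊞-Closed (sup⁺ I f)) where
  open Preorder A using (Carrier; _≲_) renaming (refl to ≲-refl; trans to ≲-trans)
  open Width A
  open Multiples I f closed using (δ)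

  Small : (Carrier → Set p) → Set (c ⊔ p ⊔ ℓ₂ ⊔ ℓ)
  Small X = ∃ λ i → Width≤ X (f i)

  small-⊆ : (X : Carrier → Set p) (Y : Carrier → Set q) →
            (∀ {x} → Y x → X x) → Small X → Small Y
  small-⊆ X Y Y⊆X (i , w) = i , ≤-mono X Y (f i) (f i) Y⊆X (≤-refl (f i)) w

  small-∪ : (X : Carrier → Set p) (Y : Carrier → Set q) (Z : Carrier → Set r) →
            (∀ {z} → Z z → X z ⊎ Y z) → Small X → Small Y → Small Z
  small-∪ X Y Z Z⊆X∪Y (i , w) (j , v) =
    let k , le = closed i j
    in  k , ≤-mono Z Z (f i ⊞ f j) (f k) id le (≤-∪ X Y Z (f i) (f j) Z⊆X∪Y w v)

  -- Since the bound `f i` fails, `>⊎≤` supplies a first element leaving width `f i`, which is the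
  -- move required at branch i of `δ`.
  large⇒≥ : (X : Carrier → Set p) → ¬ Small X → Width≥ X δ
  large⇒≥ X large i = fromInj₁ (λ w → contradiction (i , w) large) (>⊎≤ em X (f i))

  ≥⇒large : (X : Carrier → Set p) → Width≥ X δ → ¬ Small X
  ≥⇒large X w (i , v) = ≰-branch δ i (≥⇒≤⇒≤ X δ (f i) w v)

  _↓_ : (Carrier → Set p) → Carrier → Carrier → Set (p ⊔ ℓ₂)
  (X ↓ x) y = X y × y ≲ x

  large-∖↓ : (X : Carrier → Set p) (s : List Carrier) → ¬ Small X →
             All (λ x → Small (X ↓ x)) s →
             ¬ Small (λ y → X y × All (λ x → ¬ (y ≲ x)) s)
  large-∖↓ X []      large []       small = large (small-⊆ _ X (_, []) small)
  large-∖↓ X (x ∷ s) large (↓x ∷ ↓s) small =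
    large-∖↓ X s large ↓s (small-∪ (X ↓ x) _ _ split ↓x small)
    where
    split : ∀ {y} → X y × All (λ x → ¬ (y ≲ x)) s →
            (X ↓ x) y ⊎ (X y × All (λ x → ¬ (y ≲ x)) (x ∷ s))
    split {y} (Xy , y≴s) with em {P = y ≲ x}
    ... | yes y≲x = inj₁ (Xy , y≲x)
    ... | no  y≴x = inj₂ (Xy , y≴x ∷ y≴s)

  Tame : (Carrier → Set p) → Set (c ⊔ p ⊔ ℓ₂ ⊔ ℓ)
  Tame X = ∀ {x} → X x → Small (X ↓ x)

  -- If some principal ideal is large, a minimal large one minus the
  -- equivalence class of its top is large and tame.
  tame-large : IsWQO A → 𝟎 {ℓ} +1 < δ → (X : Carrier → Set p) → ¬ Small X →
               ∃ λ (Y : Carrier → Set (p ⊔ ℓ₂)) →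
                 (∀ {x} → Y x → X x) × ¬ Small Y × Tame Y
  tame-large wqo (i₁ , 1≤) X large with em {P = ∃ λ x → X x × ¬ Small (X ↓ x)}
  ... | no none =
    -- X itself is tame here; the reflexivity conjunct only lifts it to the universe level of the
    -- other case.
    (λ x → X x × x ≲ x) , proj₁ ,
    (λ small → large (small-⊆ _ X (_, ≲-refl) small)) ,
    (λ { {x} (Xx , _) → decidable-stable em λ ↓-large →
      none (x , Xx , λ small → ↓-large (small-⊆ (X ↓ x) _ (λ ((Xy , _) , y≲x) → Xy , y≲x) small)) })
  ... | yes x₀ = (λ x → (X ↓ m) x × ¬ (m ≲ x)) , proj₁ ∘ proj₁ , large′ , tame
    where
    minimal : ∃ λ x → (X x × ¬ Small (X ↓ x)) × (∀ {y} → X y × ¬ Small (X ↓ y) → y ≲ x → x ≲ y)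
    minimal = wqo-minimal em A wqo (λ x → X x × ¬ Small (X ↓ x)) x₀

    m : Carrier
    m = proj₁ minimal

    Class : Carrier → Set _
    Class x = x ≲ m × m ≲ x

    -- Members of one class are comparable, so a single move exhausts it.
    class-width : Width≤ Class (𝟎 {ℓ} +1)
    class-width x (_ , m≲x) = tt , λ y ((y≲m , _) , y≴x , _) → contradiction (≲-trans y≲m m≲x) y≴x

    large′ : ¬ Small (λ x → (X ↓ m) x × ¬ (m ≲ x))
    large′ small = proj₂ (proj₁ (proj₂ minimal))
      (small-∪ _ Class (X ↓ m) split small (i₁ , ≤-mono Class Class (𝟎 +1) (f i₁) id 1≤ class-width))
      where
      split : ∀ {x} → (X ↓ m) x → ((X ↓ m) x × ¬ (m ≲ x)) ⊎ Class x
      split {x} (Xx , x≲m) with em {P = m ≲ x}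
      ... | yes m≲x = inj₂ (x≲m , m≲x)
      ... | no  m≴x = inj₁ ((Xx , x≲m) , m≴x)

    tame : Tame (λ x → (X ↓ m) x × ¬ (m ≲ x))
    tame {x} ((Xx , x≲m) , m≴x) = small-⊆ (X ↓ x) _ (λ (((Xy , _) , _) , y≲x) → Xy , y≲x)
      (decidable-stable em λ ↓-large → m≴x (proj₂ (proj₂ minimal) (Xx , ↓-large) x≲m))

-- Finite subsets

-- The sets with x precede those without x, so that over an antichain no set is contained in a later
-- one.
subsets : {C : Set c} → List C → List (List C)
subsets []       = [] ∷ []
subsets (x ∷ xs) = map (x ∷_) (subsets xs) ++ subsets xs

subsets-All : {C : Set c} {P : C → Set p} {xs : List C} → All P xs → All (All P) (subsets xs)
subsets-All []         = [] ∷ []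
subsets-All (px ∷ pxs) =
  All.++⁺ (All.map⁺ (All.map (px ∷_) (subsets-All pxs))) (subsets-All pxs)

length-subsets : {C : Set c} (x : C) (xs : List C) →
  length (subsets (x ∷ xs)) ≡ length (subsets xs) ℕ.+ length (subsets xs)
length-subsets x xs = trans (length-++ (map (x ∷_) (subsets xs)))
  (cong (ℕ._+ length (subsets xs)) (length-map (x ∷_) (subsets xs)))

module Powerset (A : Preorder c ℓ₁ ℓ₂) where
  open Preorder A using (Carrier; _≲_; ≲-respʳ-≈; ≲-respˡ-≈; module Eq)
  open Inco A using (Incomparable)
  open Hoare A using (_≤ᴴ_)
  open Preorder (𝒫f A) using () renaming (trans to ≤ᴴ-trans)
  open Membership Eq.setoid using () renaming (_∈_ to _∈≈_)

  -- Through `All` and `Any` the Hoare order can be split along `_++_`.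
  ≤ᴴ⇒All : ∀ S {T} → S ≤ᴴ T → All (λ a → Any (a ≲_) T) S
  ≤ᴴ⇒All []      S≤T = []
  ≤ᴴ⇒All (a ∷ S) S≤T =
    (let b , b∈T , a≲b = S≤T a (here Eq.refl) in Any.map (λ b≈c → ≲-respʳ-≈ b≈c a≲b) b∈T) ∷
    ≤ᴴ⇒All S (λ a′ → S≤T a′ ∘ there)

  Any⇒∈ : ∀ {a T} → Any (a ≲_) T → ∃ λ b → (b ∈≈ T) × (a ≲ b)
  Any⇒∈ (here a≲b)   = _ , here Eq.refl , a≲b
  Any⇒∈ (there a≲T) = let b , b∈T , a≲b = Any⇒∈ a≲T in b , there b∈T , a≲b

  All⇒≤ᴴ : ∀ {S T} → All (λ a → Any (a ≲_) T) S → S ≤ᴴ T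
  All⇒≤ᴴ (a≲T ∷ _)  _ (here a′≈a) =
    let b , b∈T , a≲b = Any⇒∈ a≲T in b , b∈T , ≲-respˡ-≈ (Eq.sym a′≈a) a≲b
  All⇒≤ᴴ (_ ∷ S≲T) a (there a∈S) = All⇒≤ᴴ S≲T a a∈S

  Apart : (Carrier → Set p) → Carrier → Set (c ⊔ p ⊔ ℓ₂)
  Apart B a = ∀ {b} → B b → Incomparable a b

  NotBelow : (Carrier → Set p) → List Carrier → Carrier → Set (c ⊔ p ⊔ ℓ₂)
  NotBelow B Y a = All (λ b → ¬ (a ≲ b)) Y × (∀ {b} → B b → ¬ (a ≲ b))

  -- S ++ X ≰ T ++ Y for all S and all T ⊆ B, because of a member of X.
  Exceeds : (Carrier → Set p) → List Carrier → List Carrier → Set (c ⊔ p ⊔ ℓ₂)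
  Exceeds B X Y = Any (NotBelow B Y) X

  -- A set with x exceeds one without x at x itself. Two sets that agree about x are separated by a
  -- later member of the antichain.
  subsets-Exceeds : (B : Carrier → Set p) (xs : List Carrier) → AllPairs Incomparable xs →
                    All (Apart B) xs → AllPairs (Exceeds B) (subsets xs)
  subsets-Exceeds B []       _                _            = [] ∷ []
  subsets-Exceeds B (x ∷ xs) (x∥xs ∷ xs-anti) (x∥B ∷ xs∥B) = AllPairs.++⁺
    (AllPairs.map⁺ (AllPairs.map extend later))
    (AllPairs.map weaken later)
    (All.map⁺ (All.tabulate λ _ →
      All.map begin (subsets-All (All.map proj₁ x∥xs))))
    where
    -- Counting x as a member of B in the recursive call ensures that the separating element is not
    -- below x, so x may be added to the right-hand set.
    B′ : Carrier → Set _
    B′ b = B b ⊎ b ≡ x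

    begin : ∀ {X Y} → All (λ y → ¬ (x ≲ y)) Y → Exceeds B (x ∷ X) Y
    begin {Y = Y} x≴Y = here {P = NotBelow B Y} (x≴Y , λ Bb → proj₁ (x∥B Bb))

    extend : ∀ {X Y} → Exceeds B′ X Y → Exceeds B (x ∷ X) (x ∷ Y)
    extend {Y = Y} = there ∘ Any.map {P = NotBelow B′ Y} {Q = NotBelow B (x ∷ Y)}
      (λ (≴Y , ≴B′) → ≴B′ (inj₂ refl) ∷ ≴Y , ≴B′ ∘ inj₁)

    weaken : ∀ {X Y} → Exceeds B′ X Y → Exceeds B X Y
    weaken {Y = Y} = Any.map {P = NotBelow B′ Y} {Q = NotBelow B Y} (λ (≴Y , ≴B′) → ≴Y , ≴B′ ∘ inj₁)

    apart : ∀ {a} → Incomparable x a × Apart B a → Apart B′ a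
    apart (_   , a∥B) (inj₁ Bb)   = a∥B Bb
    apart (x∥a , _)   (inj₂ refl) = proj₂ x∥a , proj₁ x∥a

    later : AllPairs (Exceeds B′) (subsets xs)
    later = subsets-Exceeds B′ xs xs-anti (All.zipWith apart (x∥xs , xs∥B))

  ≤ᴴ-++ : ∀ S X → S ≤ᴴ S ++ X
  ≤ᴴ-++ S X a a∈S = a , Any.++⁺ˡ a∈S , Preorder.refl A

  -- A member of B is incomparable to all of X and must lie below a member of T. Hence adjoining a
  -- fixed X reflects the order on subsets of B and adds none of them to a down-set.
  ≤ᴴ-drop : {B : Carrier → Set p} → ∀ {S T X} → All B S → All (Apart B) X →
            S ≤ᴴ T ++ X → S ≤ᴴ T
  ≤ᴴ-drop {B = B} {S} {T} {X} S⊆B X∥B S≤ = All⇒≤ᴴ (All.zipWith keep (S⊆B , ≤ᴴ⇒All S S≤))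
    where
    keep : ∀ {a} → B a × Any (a ≲_) (T ++ X) → Any (a ≲_) T
    keep (Ba , a≲) = fromInj₁
      (λ a≲X → let x∥B , a≲x = All.lookupAny X∥B a≲X in contradiction a≲x (proj₂ (x∥B Ba)))
      (Any.++⁻ T a≲)

  Exceeds-≰ : {B : Carrier → Set p} → ∀ {S T X Y} → Exceeds B X Y → All B T →
              ¬ (S ++ X ≤ᴴ T ++ Y)
  Exceeds-≰ {S = S} {T} {X} {Y} ex T⊆B le
    with All.lookupAny (All.++⁻ʳ S (≤ᴴ⇒All (S ++ X) le)) ex
  ... | a≲ , a≴Y , a≴B with Any.++⁻ T a≲
  ... | inj₁ a≲T = let Bb , a≲b = All.lookupAny T⊆B a≲T in a≴B Bb a≲b
  ... | inj₂ a≲Y = let a≴b , a≲b = All.lookupAny a≴Y a≲Y in a≴b a≲b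

  Sums : (List Carrier → Set p) → List (List Carrier) → List Carrier → Set (c ⊔ p)
  Sums N Xs T = ∃ λ S → N S × ∃ λ X → (X ∈ Xs) × (T ≡ S ++ X)

  -- Antichain sequences played in phases

  module Phases (em : Classical) (I : Set ℓ) (f : I → Ord ℓ)
                (closed : ⊞-Closed (sup⁺ I f)) (B : Carrier → Set p) where
    open Multiples I f closed
    open Ideal em (𝒫f A) I f closed
    open Width (𝒫f A)

    -- The sets S ++ X, S ∈ N, are played first.  They rule out only a small
    -- part of N for the remaining phases.
    phases : (N : List Carrier → Set q) (Xs : List (List Carrier)) →
             (∀ {S} → N S → All B S) → ¬ Small N → Tame N →
             AllPairs (Exceeds B) Xs → All (All (Apart B)) Xs →
             Width≥ (Sums N Xs) (δ· (length Xs))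
    phases N []       N⊆B large tame _          _          ()
    phases N (X ∷ Xs) N⊆B large tame (ex ∷ exs) (X∥B ∷ Xs∥B) =
      ≥-+ (Sums N (X ∷ Xs)) First (Sums N Xs) (δ· (length Xs)) δ
        (λ (S , NS , T≡) → S , NS , X , here refl , T≡)
        (λ (S , NS , Y , Y∈ , T≡) → S , NS , Y , there Y∈ , T≡)
        -- The first phase has width at least `δ` because N is large and adjoining X reflects the
        -- order on it.
        (Width≥-map (𝒫f A) (𝒫f A) N First (_++ X) δ (λ {S} NS → S , NS , refl)
          (λ {S} {T} NS NT le →
            ≤ᴴ-drop {S = S} {T} {X} (N⊆B NS) X∥B (≤ᴴ-trans {S} {S ++ X} {T ++ X} (≤ᴴ-++ S X) le))
          (large⇒≥ N large))
        rest
      where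
      First : List Carrier → Set _
      First T = ∃ λ S → N S × (T ≡ S ++ X)

      rest : ∀ s → All First s → Width≥ (Sums N Xs ∥* s) (δ· (length Xs))
      rest s first = ≥-⊆ (Sums N′ Xs) (Sums N Xs ∥* s) (δ· (length Xs)) available
        (phases N′ Xs (N⊆B ∘ proj₁) (large-∖↓ N s large (All.map small-↓ first)) tame′ exs Xs∥B)
        where
        -- By tameness only finitely many small down-sets are removed, so this remainder of N is
        -- still large.
        N′ : List Carrier → Set _
        N′ S = N S × All (λ T → ¬ (S ≤ᴴ T)) s

        small-↓ : ∀ {T} → First T → Small (N ↓ T)
        small-↓ (S , NS , refl) = small-⊆ (N ↓ S) (N ↓ (S ++ X))
          (λ {R} (NR , R≤) → NR , ≤ᴴ-drop {S = R} {S} {X} (N⊆B NR) X∥B R≤) (tame NS)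

        tame′ : Tame N′
        tame′ {S} (NS , _) = small-⊆ (N ↓ S) (N′ ↓ S) (λ ((NR , _) , R≤S) → NR , R≤S) (tame NS)

        available : ∀ {T} → Sums N′ Xs T → (Sums N Xs ∥* s) T
        available (S , (NS , S≰s) , Y , Y∈Xs , refl) =
          (S , NS , Y , Y∈Xs , refl) , All.zipWith incomparable (S≰s , first)
          where
          incomparable : ∀ {T} → ¬ (S ≤ᴴ T) × First T → Inco.Incomparable (𝒫f A) (S ++ Y) T
          incomparable {T} (S≰T , R , NR , refl) =
            -- The later set is not below the earlier one because its N-part avoids the earlier
            -- down-sets; the converse fails because X exceeds the later Y.
            (λ le → S≰T (≤ᴴ-trans {S} {S ++ Y} {T} (≤ᴴ-++ S Y) le)) ,
            Exceeds-≰ {S = R} {S} {X} {Y} (All.lookup ex Y∈Xs) (N⊆B NS)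

  -- Induction on the width of a subset B

  module _ (em : Classical) (wqo : IsWQO A) where
    open Width A using (_∥_)

    private
      module Wᴬ = Width A
      module Wᴾ = Width (𝒫f A)

    singletons : (B : Carrier → Set p) (α : Ord q) → Wᴬ.Width≥ B α → Wᴾ.Width≥ (All B) α
    singletons B α = Width≥-map A (𝒫f A) B (All B) (_∷ []) α (_∷ [])
      (λ {x} _ _ le → case-here (≤ᴴ⇒All (x ∷ []) le))
      where
      case-here : ∀ {x y} → All (λ a → Any (a ≲_) (y ∷ [])) (x ∷ []) → x ≲ y
      case-here (here x≲y ∷ []) = x≲y

    limit-step : (I : Set ℓ) (f : I → Ord ℓ) (i₀ : I) (limit : ∀ i → ∃ λ j → f i < f j)
                 (B : Carrier → Set p) (xs : List Carrier) →
                 AllPairs Incomparable xs → All (Apart B) xs →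
                 Wᴾ.Width≥ (All B) (E (sup⁺ I f)) →
                 Wᴾ.Width≥ (Sums (All B) (subsets xs)) (2^ length xs · E (sup⁺ I f))
    limit-step I f i₀ limit B xs xs-anti xs∥B w =
      let N , N⊆ , large , tame = tame-large (𝒫f-wqo em A wqo) 1<E (All B) (≥⇒large (All B) w)
      in  Wᴾ.≥-mono (Sums N (subsets xs)) (Sums (All B) (subsets xs))
            (δ· (length (subsets xs))) (2^ length xs · δ)
            (λ (S , NS , rest) → S , N⊆ NS , rest) (2^≤δ· xs)
            (phases N (subsets xs) N⊆ large tame
              (subsets-Exceeds B xs xs-anti xs∥B) (subsets-All xs∥B))
      where
      open Limit em I f i₀ limit
      open Multiples (Branch (E (sup⁺ I f))) (branch (E (sup⁺ I f))) E-closed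
      open Ideal em (𝒫f A) (Branch δ) (branch δ) E-closed
      open Phases em (Branch δ) (branch δ) E-closed B

      2^≤δ· : (ys : List Carrier) → 2^ length ys · δ ≤ δ· (length (subsets ys))
      2^≤δ· []       = ≤-+ʳ 𝟎 δ
      2^≤δ· (y ∷ ys) = subst (λ n → 2^ length (y ∷ ys) · δ ≤ δ· n) (sym (length-subsets y ys))
        (≤-trans (2^ length (y ∷ ys) · δ) (δ· n ⊞ δ· n) (δ· (n ℕ.+ n))
          (⊞-mono (2^ length ys · δ) (2^ length ys · δ) (δ· n) (δ· n) (2^≤δ· ys) (2^≤δ· ys))
          (δ·-⊞ (0<E (sup⁺ I f)) n n))
        where
        n : ℕ
        n = length (subsets ys)

    -- Carrying the reserved antichain along avoids decomposing `β` as a limit plus n: a successor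
    -- moves one element of B into xs and so trades one step of `E` for one doubling, and at the
    -- limit `limit-step` pays for all doublings at once.
    growth : (β : Ord ℓ) (B : Carrier → Set p) (xs : List Carrier) →
             AllPairs Incomparable xs → All (Apart B) xs → ω ≤ β → Wᴬ.Width≥ B β →
             Wᴾ.Width≥ (Sums (All B) (subsets xs)) (2^ length xs · E β)
    growth β@(sup⁺ I f) B xs xs-anti xs∥B ω≤β w = [ limit , successor ] limit-or-successor
      where
      i₀ : I
      i₀ = proj₁ (ω≤β 0)

      IsLimit : Set _
      IsLimit = ∀ i → ∃ λ j → f i < f j

      limit-or-successor : IsLimit ⊎ ∃ λ i → ∀ j → f j ≤ f i
      limit-or-successor with em {P = IsLimit}
      ... | yes lim = inj₁ lim
      ... | no ¬lim = inj₂ (decidable-stable em λ none → ¬lim λ i → decidable-stable em λ stuck →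
        none (i , λ j → fromInj₂ (λ fi<fj → contradiction (j , fi<fj) stuck) (<⊎≥ em (f i) (f j))))

      limit : IsLimit → Wᴾ.Width≥ (Sums (All B) (subsets xs)) (2^ length xs · E β)
      -- As the `E (f i)` are cofinal in `E β`, the width of `All B` can be bounded one branch of
      -- `β` at a time.
      limit lim = limit-step I f i₀ lim B xs xs-anti xs∥B λ k →
        let i , k< = Limit.E-branch-< em I f i₀ lim k
            x , Bx , v = Wᴾ.≥-branch (All B) (E (f i)) (all i) (proj₁ k<)
        in  x , Bx , Wᴾ.≥-mono (All B Wᴾ.∥ x) (All B Wᴾ.∥ x)
                       (branch (E (f i)) (proj₁ k<)) (branch (E β) k) id (proj₂ k<) v
        where
        all : ∀ i → Wᴾ.Width≥ (All B) (E (f i))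
        all i with ω≤-or-finite em (f i)
        ... | inj₁ ω≤fi = let j , lt = lim i in
          Wᴾ.≥-⊆ (Sums (All B) ([] ∷ [])) (All B) (E (f i))
            (λ { (S , S⊆B , .[] , here refl , refl) → All.++⁺ S⊆B [] })
            (growth (f i) B [] [] [] ω≤fi
              (Wᴬ.≥-mono B B β (f i) id (<⇒≤ (f i) β (i , ≤-refl (f i))) w))
        -- The induction hypothesis starts only at `ω`; here `E (f i)` is finite, and the singletons
        -- of B already give width `ω`.
        ... | inj₂ (n , fi≤n) = let m , En≤m = E-finite n in
          Wᴾ.≥-mono (All B) (All B) ω (E (f i)) id
            (≤-trans (E (f i)) (E (fromℕ n)) ω (E-mono (f i) (fromℕ n) fi≤n)
              (≤-trans (E (fromℕ n)) (fromℕ m) ω En≤m (fromℕ≤ω m)))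
            (singletons B ω (Wᴬ.≥-mono B B β ω id ω≤β w))

      successor : (∃ λ i → ∀ j → f j ≤ f i) →
                  Wᴾ.Width≥ (Sums (All B) (subsets xs)) (2^ length xs · E β)
      successor (i , top) =
        Wᴾ.≥-mono (Sums (All (B ∥ x)) (subsets (x ∷ xs))) (Sums (All B) (subsets xs))
          (2^ length (x ∷ xs) · E (f i)) (2^ length xs · E β) absorb
          (subst (2^ length xs · E β ≤_) (2^·-⊞ (length xs) (E (f i)))
            (2^·-mono (length xs) (E β) (E (f i) ⊞ E (f i)) (E-suc β (f i) λ j → tt , top j)))
          (growth (f i) (B ∥ x) (x ∷ xs)
            (All.map (λ a∥B → swap (a∥B Bx)) xs∥B ∷ xs-anti)
            ((λ (_ , y∥x) → swap y∥x) ∷ All.map (λ a∥B {_} (By , _) → a∥B By) xs∥B)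
            ω≤fi (proj₂ (proj₂ (w i))))
        where
        -- The element to reserve is the move at the top branch, which leaves width `f i` in
        -- `B ∥ x`.
        x : Carrier
        x = proj₁ (w i)

        Bx : B x
        Bx = proj₁ (proj₂ (w i))

        -- Each n + 1 lies below some branch of `β`, hence below the top one, so the predecessor is
        -- still infinite.
        ω≤fi : ω ≤ f i
        ω≤fi = branches-≤ ω (f i) λ n →
          let j , n<fj = ω≤β (suc n)
          in  ≤-branch (fromℕ n +1) (f i) (≤-trans (fromℕ n +1) (f j) (f i) n<fj (top j)) tt

        -- If the reserved x occurs, it is moved from the X-part to the B-part, where it belongs by
        -- `Bx`.
        absorb : ∀ {T} → Sums (All (B ∥ x)) (subsets (x ∷ xs)) T → Sums (All B) (subsets xs) T
        absorb (S , S⊆ , X , X∈ , refl) with ∈-++⁻ (map (x ∷_) (subsets xs)) X∈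
        ... | inj₂ X∈xs = S , All.map proj₁ S⊆ , X , X∈xs , refl
        ... | inj₁ X∈x∷ with ∈-map⁻ (x ∷_) X∈x∷
        ... | Y , Y∈xs , refl = S ++ x ∷ [] , All.++⁺ (All.map proj₁ S⊆) (Bx ∷ []) ,
          Y , Y∈xs , sym (++-assoc S (x ∷ []) Y)

-- The bounds for infinite and for finite width

width-2^ : (em : Classical) (A : Preorder c ℓ₁ ℓ₂) (wqo : IsWQO A) →
  ω ≤ 𝐰 em A wqo → 2^ (𝐰 em A wqo) ≤ 𝐰 em (𝒫f A) (𝒫f-wqo em A wqo)
width-2^ {c = c} {ℓ₂ = ℓ₂} em A wqo ω≤α =
  ≤-trans (2^ α) (E α) (𝐰 em (𝒫f A) (𝒫f-wqo em A wqo)) (2^≤E α)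
    (Wᴾ.≥⇒≤rank (Inco.root (𝒫f A)) (Inco.root-acc (𝒫f A) em (𝒫f-wqo em A wqo)) (E α)
      (Wᴾ.≥-⊆ (Sums (All B) ([] ∷ [])) (Wᴾ.Available (Inco.root (𝒫f A))) (E α) (λ _ → [])
        (growth em wqo α B [] [] [] ω≤α
          (Wᴬ.rank-≥ (Inco.root A) (Inco.root-acc A em wqo)))))
  where
  open Powerset A
  module Wᴬ = Width A
  module Wᴾ = Width (𝒫f A)

  α : Ord (c ⊔ ℓ₂)
  α = 𝐰 em A wqo

  -- Availability at the root is vacuous, so B is all of A.
  B : Preorder.Carrier A → Set (c ⊔ ℓ₂)
  B = Wᴬ.Available (Inco.root A)

-- Successive moves of the strategy are pairwise incomparable; the last component says that e
-- reflects the order of `Γ k`.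
antichain : (A : Preorder c ℓ₁ ℓ₂) → let open Preorder A in
  (X : Carrier → Set p) (k : ℕ) → Width.Width≥ A X (fromℕ k) →
  ∃ λ (e : Fin k → Carrier) → (∀ i → X (e i)) × (∀ i j → e i ≲ e j → i ≡ j)
antichain A X zero    _ = (λ ()) , (λ ()) , λ ()
antichain A X (suc k) w =
  let x , Xx , v    = w tt
      e , Xe , anti = antichain A (Width._∥_ A X x) k v
  in  (λ { zero → x ; (suc i) → e i }) ,
      (λ { zero → Xx ; (suc i) → proj₁ (Xe i) }) ,
      λ { zero    zero    _  → refl
        ; zero    (suc j) le → contradiction le (proj₂ (proj₂ (Xe j)))
        ; (suc i) zero    le → contradiction le (proj₁ (proj₂ (Xe i)))
        ; (suc i) (suc j) le → cong suc (anti i j le) }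

-- Taking images under a k-element antichain of A reflects the Hoare order, so it transports
-- antichain sequences from `𝒫f (Γ k)`.
width-Γ : (em : Classical) (A : Preorder c ℓ₁ ℓ₂) (wqo : IsWQO A) (k : ℕ) →
  fromℕ k ≤ 𝐰 em A wqo →
  𝐰 em (𝒫f (Γ k)) (𝒫f-wqo em (Γ k) (Γ-wqo k)) ≤ 𝐰 em (𝒫f A) (𝒫f-wqo em A wqo)
width-Γ em A wqo k k≤w =
  Wᴾ.≥⇒≤rank (Inco.root (𝒫f A)) (Inco.root-acc (𝒫f A) em (𝒫f-wqo em A wqo)) α
    (Width≥-map (𝒫f (Γ k)) (𝒫f A) (Wᴳ.Available (Inco.root (𝒫f (Γ k))))
      (Wᴾ.Available (Inco.root (𝒫f A))) (map e) α (λ _ → []) (λ {S} _ _ → reflects S)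
      (Wᴳ.rank-≥ (Inco.root (𝒫f (Γ k)))
        (Inco.root-acc (𝒫f (Γ k)) em (𝒫f-wqo em (Γ k) (Γ-wqo k)))))
  where
  module Wᴬ = Width A
  module Wᴳ = Width (𝒫f (Γ k))
  module Wᴾ = Width (𝒫f A)

  α : Ord _
  α = 𝐰 em (𝒫f (Γ k)) (𝒫f-wqo em (Γ k) (Γ-wqo k))

  embedding : ∃ λ (e : Fin k → Preorder.Carrier A) →
    (∀ i → Wᴬ.Available (Inco.root A) (e i)) × (∀ i j → Preorder._≲_ A (e i) (e j) → i ≡ j)
  embedding = antichain A (Wᴬ.Available (Inco.root A)) k
    (Wᴬ.≥-mono (Wᴬ.Available (Inco.root A)) (Wᴬ.Available (Inco.root A)) (𝐰 em A wqo) (fromℕ k)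
      id k≤w (Wᴬ.rank-≥ (Inco.root A) (Inco.root-acc A em wqo)))

  e : Fin k → Preorder.Carrier A
  e = proj₁ embedding

  reflects : ∀ S {T} → Hoare._≤ᴴ_ A (map e S) (map e T) → Hoare._≤ᴴ_ (Γ k) S T
  reflects S le = Powerset.All⇒≤ᴴ (Γ k)
    (All.map (Any.map (proj₂ (proj₂ embedding) _ _) ∘ Any.map⁻)
      (All.map⁻ (Powerset.≤ᴴ⇒All A (map e S) le)))

mainTheorem3 : (em : Classical) →
    ∀ {c ℓ₁ ℓ₂} (A : Preorder c ℓ₁ ℓ₂) (wqo : IsWQO A) →
    (ω ≤ 𝐰 em A wqo → 2^ (𝐰 em A wqo) ≤ 𝐰 em (𝒫f A) (𝒫f-wqo em A wqo)) ×
    ((k : ℕ) → 𝐰 em A wqo ≃ fromℕ k →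
    𝐰 em (𝒫f (Γ k)) (𝒫f-wqo em (Γ k) (Γ-wqo k)) ≤ 𝐰 em (𝒫f A) (𝒫f-wqo em A wqo))
mainTheorem3 em A wqo =
  width-2^ em A wqo , λ k (_ , k≤w) → width-Γ em A wqo k k≤w
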